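{- Let $q=3^n$ with $n\ge 3$, and let \[ f(X)=aX^2+bX+\frac{1}{X-r}+\frac{1}{X+r}, \] where $a\in\mathbb{F}_q^*$, $b\in\mathbb{F}_q$, $r\in\mathbb{F}_{q^2}\setminus\mathbb{F}_q$ and $r^2\in\mathbb{F}_q$. Then $f$ is not a permutation rational function of $\mathbb{P}^1(\mathbb{F}_q)$.
   Context: $\mathbb{P}^1(\mathbb{F}_q)=\mathbb{F}_q\cup\{\infty\}$ is the projective line over $\mathbb{F}_q$. A rational function $f=P/Q\in\mathbb{F}_q(X)$ ($P,Q$ coprime) defines a map $\mathbb{P}^1(\mathbb{F}_q)\to\mathbb{P}^1(\mathbb{F}_q)$ in the usual way (zeros of $Q$ map to $\infty$, and $f(\infty)$ is the limiting value). A permutation rational function of $\mathbb{P}^1(\mathbb{F}_q)$ is a rational function whose induced map on $\mathbb{P}^1(\mathbb{F}_q)$ is a bijection. -}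

module Defs where

open import Level using (0ℓ)
open import Data.Nat using (ℕ)
open import Data.Fin using (Fin)
open import Data.Maybe using (Maybe; just; nothing)
open import Data.Product using (_×_; ∃-syntax)
open import Relation.Binary.PropositionalEquality using (_≡_; _≢_)
open import Relation.Nullary using (¬_)
open import Function.Bundles using (_↔_)
open import Algebra.Structures using (IsCommutativeRing)

-- A finite field with exactly q elements.  Equality is propositional
-- (every finite field is isomorphic to one carried by e.g. Fin q, so
-- this is no loss of generality).  The inverse is a total operation
-- whose value at 0 is unconstrained; it is a genuine inverse on nonzero
-- elements.
record FiniteField (q : ℕ) : Set₁ where
  infixl 7 _*_
  infixl 6 _+_ _-_
  field
    Carrier : Set
    _+_ _*_ : Carrier → Carrier → Carrier
    -_ : Carrier → Carrier
    _⁻¹ : Carrier → Carrier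
    0# 1# : Carrier
    isCommutativeRing : IsCommutativeRing _≡_ _+_ _*_ -_ 0# 1#
    0≢1 : 0# ≢ 1#
    ⁻¹-inverse : ∀ x → x ≢ 0# → x * (x ⁻¹) ≡ 1#
    enumeration : Fin q ↔ Carrier

  _-_ : Carrier → Carrier → Carrier
  x - y = x + (- y)

record Embedding {q q' : ℕ} (K : FiniteField q) (L : FiniteField q') : Set where
  private
    module K = FiniteField K
    module L = FiniteField L
  field
    ι : K.Carrier → L.Carrier
    ι-+ : ∀ x y → ι (x K.+ y) ≡ ι x L.+ ι y
    ι-* : ∀ x y → ι (x K.* y) ≡ ι x L.* ι y
    ι-1 : ι K.1# ≡ L.1#
    ι-injective : ∀ x y → ι x ≡ ι y → x ≡ y

-- The projective line P¹(F) = F ∪ {∞}; nothing represents ∞.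
P1 : ∀ {q} → FiniteField q → Set
P1 F = Maybe (FiniteField.Carrier F)

liftP1 : ∀ {q q'} {K : FiniteField q} {L : FiniteField q'} →
         Embedding K L → P1 K → P1 L
liftP1 e nothing  = nothing
liftP1 e (just x) = just (Embedding.ι e x)

-- The map P¹(K) → P¹(L) induced by
--   f(X) = a X² + b X + 1/(X - r) + 1/(X + r)
-- (a, b ∈ K, r ∈ L, computed inside L ⊇ K).  At finite x the value is
-- computed in L (x ± r ≠ 0 there since r ∉ K); f(∞) = ∞ since f has a
-- pole at ∞ (a ≠ 0, degree of numerator 4 > 2 = degree of denominator).
fMap : ∀ {q q'} (K : FiniteField q) (L : FiniteField q') → Embedding K L →
       FiniteField.Carrier K → FiniteField.Carrier K → FiniteField.Carrier L →
       P1 K → P1 L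
fMap K L e a b r nothing = nothing
fMap K L e a b r (just x) =
  just (ι a * (ι x * ι x) + ι b * ι x + (ι x - r) ⁻¹ + (ι x + r) ⁻¹)
  where
  open FiniteField L
  open Embedding e

IsPermutationP1 : ∀ {q q'} {K : FiniteField q} {L : FiniteField q'} →
                  Embedding K L → (P1 K → P1 L) → Set
IsPermutationP1 {K = K} e F =
  (∀ x → ∃[ y ] F x ≡ liftP1 e y)
  × (∀ x y → F x ≡ F y → x ≡ y)
  × (∀ (y : P1 K) → ∃[ x ] F x ≡ liftP1 e y)

{-# OPTIONS --safe #-}
module Submission where

-- Put c = r² and v(x) = c/(x² - c).  In characteristic 3, f(x) = ax² + bx - x v(x)/c on 𝔽_q.  If f permuted
-- 𝔽_q, then Σ f(x)² = 0 and Σ f(x)⁵ = 0.  Since x²v = c(1 + v), all the sums Σ xᵐv(x)ᵏ that occur when these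
-- powers are expanded reduce to T_k = Σ v(x)ᵏ for k ≤ 4, sums of odd functions (which vanish), and power sums
-- of degree below q - 1 (which vanish as well; this is where q ≥ 27 enters).  The Möbius transformations
-- N(x) = -(αx + c)/(x + α) fix the set {r, -r} and satisfy (α² - c) v(N x) = (x + α)² v(x), which gives linear
-- relations between the T_k and hence T₁ = 1, T₂ = 0, T₃ = 1, T₄ = 1.  Now Σ f² = 0 says bc = -1, so that
-- f(x) = ax² - x³v(x)/c², and then Σ f⁵ = -a/c, which is not 0.

open import Defs
open import Level using (0ℓ)
open import Algebra.Bundles using (CommutativeRing; RawRing)
import Algebra.Properties.CommutativeSemiring.Exp as Exp
import Algebra.Properties.Group as GroupProperties
import Algebra.Properties.Ring as RingProperties
import Algebra.Properties.Semiring.Mult as Mult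
import Algebra.Properties.Semiring.Sum as Sum
import Algebra.Solver.Ring as RingSolver
import Algebra.Solver.Ring.NaturalCoefficients.Default as SemiringSolver
open import Algebra.Solver.Ring.AlmostCommutativeRing using (fromCommutativeRing; _-Raw-AlmostCommutative⟶_)
open import Data.Empty using (⊥; ⊥-elim)
open import Data.Fin using (Fin; zero; suc; inject≤)
import Data.Fin.Properties as Fin
open import Data.List using (List; []; _∷_)
open import Data.List.Relation.Unary.All using (All; []; _∷_; all?)
open import Data.Maybe using (Maybe; just; nothing)
open import Data.Maybe.Properties using (just-injective)
open import Data.Nat as ℕ using (ℕ; zero; suc; _≤_; _^_; s≤s)
import Data.Nat.Properties as ℕ
open import Data.Product using (∃-syntax; _×_; _,_; proj₁; proj₂)
open import Data.Sum using (_⊎_; inj₁; inj₂; [_,_]′)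
open import Data.Vec using (Vec; []; _∷_; replicate)
open import Function using (_∘_; _↔_; mk↔ₛ′; Injection; Inverse)
open import Function.Definitions using (Injective)
open import Function.Properties.Inverse using (↔-sym; ↔-trans; Inverse⇒Injection)
open import Relation.Binary.PropositionalEquality using (_≡_; _≢_; refl; sym; trans; cong; cong₂; subst; module ≡-Reasoning)
open import Relation.Nullary using (¬_; Dec; yes; no)
open import Relation.Nullary.Decidable using (via-injection; decidable-stable; True; toWitness)

open ≡-Reasoning

-- Finite fields: sums over all elements, characteristic, roots of polynomials, power sums.

module FiniteFieldProperties {q : ℕ} (F : FiniteField q) where
  open FiniteField F public

  commutativeRing : CommutativeRing 0ℓ 0ℓ
  commutativeRing = record { isCommutativeRing = isCommutativeRing }

  open CommutativeRing commutativeRing public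
    using
      ( +-assoc; +-comm; +-identityˡ; +-identityʳ; -‿inverseˡ; -‿inverseʳ
      ; *-assoc; *-comm; *-identityˡ; *-identityʳ; distribˡ; zeroˡ; zeroʳ
      ; semiring; commutativeSemiring; ring; +-group )
  open RingProperties ring public using (-‿distribˡ-*; -‿distribʳ-*)
  open GroupProperties +-group public using () renaming
    ( ⁻¹-involutive to -‿involutive; identityʳ-unique to +-identityʳ-unique
    ; x∙y⁻¹≈ε⇒x≈y to x-y≡0⇒x≡y; inverseˡ-unique to +-inverseˡ-unique )
  open Exp commutativeSemiring public using (^-distrib-*) renaming (_^_ to _↑_)
  open Sum semiring using (sum; sum-cong-≗; ∑-distrib-+; *-distribˡ-sum; ∑-permute; sum-replicate)
  open Mult semiring using (×1-homo-*) renaming (_×_ to _·_)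

  infix 4 _≟_
  _≟_ : (x y : Carrier) → Dec (x ≡ y)
  _≟_ = via-injection (Inverse⇒Injection (↔-sym enumeration)) Fin._≟_

  open SemiringSolver commutativeSemiring using (solve; con; _:+_; _:*_; _:=_)

  element : Fin q → Carrier
  element = Inverse.to enumeration

  element-injective : Injective _≡_ _≡_ element
  element-injective = Injection.injective (Inverse⇒Injection enumeration)

  *-cancelˡ-0 : ∀ {x y} → x ≢ 0# → x * y ≡ 0# → y ≡ 0#
  *-cancelˡ-0 {x} {y} x≢0 xy≡0 = begin
    y                  ≡⟨ *-identityˡ y ⟨
    1# * y             ≡⟨ cong (_* y) (⁻¹-inverse x x≢0) ⟨
    x * x ⁻¹ * y       ≡⟨ cong (_* y) (*-comm x (x ⁻¹)) ⟩
    x ⁻¹ * x * y       ≡⟨ *-assoc (x ⁻¹) x y ⟩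
    x ⁻¹ * (x * y)     ≡⟨ cong (x ⁻¹ *_) xy≡0 ⟩
    x ⁻¹ * 0#          ≡⟨ zeroʳ (x ⁻¹) ⟩
    0#                 ∎

  zero-product : ∀ {x y} → x * y ≡ 0# → x ≡ 0# ⊎ y ≡ 0#
  zero-product {x} xy≡0 with x ≟ 0#
  ... | yes x≡0 = inj₁ x≡0
  ... | no x≢0 = inj₂ (*-cancelˡ-0 x≢0 xy≡0)

  ^-zero : ∀ x n → x ↑ n ≡ 0# → x ≡ 0#
  ^-zero x zero 1≡0 = ⊥-elim (0≢1 (sym 1≡0))
  ^-zero x (suc n) x*xⁿ≡0 = [ (λ p → p) , ^-zero x n ]′ (zero-product x*xⁿ≡0)

  x≢y⇒x-y≢0 : ∀ {x y} → x ≢ y → x - y ≢ 0#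
  x≢y⇒x-y≢0 {x} {y} x≢y x-y≡0 = x≢y (x-y≡0⇒x≡y x y x-y≡0)

  ∑ : (Carrier → Carrier) → Carrier
  ∑ f = sum (f ∘ element)

  ∑-cong : ∀ {f g} → (∀ x → f x ≡ g x) → ∑ f ≡ ∑ g
  ∑-cong f≗g = sum-cong-≗ (f≗g ∘ element)

  ∑-+ : ∀ f g → ∑ (λ x → f x + g x) ≡ ∑ f + ∑ g
  ∑-+ f g = ∑-distrib-+ (f ∘ element) (g ∘ element)

  ∑-* : ∀ y f → ∑ (λ x → y * f x) ≡ y * ∑ f
  ∑-* y f = sym (*-distribˡ-sum y (f ∘ element))

  ∑-permutation : ∀ f (π : Carrier ↔ Carrier) → ∑ (f ∘ Inverse.to π) ≡ ∑ f
  ∑-permutation f π = begin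
    ∑ (f ∘ Inverse.to π)                          ≡⟨ sum-cong-≗ {q} relabel ⟩
    sum (f ∘ element ∘ Inverse.to π′)             ≡⟨ ∑-permute (f ∘ element) π′ ⟨
    ∑ f                                           ∎
    where
    π′ = ↔-trans enumeration (↔-trans π (↔-sym enumeration))
    relabel : ∀ i → f (Inverse.to π (element i)) ≡ f (element (Inverse.to π′ i))
    relabel i = cong f (sym (Inverse.strictlyInverseˡ enumeration (Inverse.to π (element i))))

  -- Translation by `y` permutes the field, so adding `y` to every term leaves the sum of all
  -- elements unchanged.
  ∑-const : ∀ y → ∑ (λ _ → y) ≡ 0#
  ∑-const y = +-identityʳ-unique (∑ (λ x → x)) _ (begin
    ∑ (λ x → x) + ∑ (λ _ → y)  ≡⟨ ∑-+ (λ x → x) (λ _ → y) ⟨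
    ∑ (λ x → x + y)            ≡⟨ ∑-permutation (λ x → x) shift ⟩
    ∑ (λ x → x)                ∎)
    where
    cancel : ∀ x {y z} → y + z ≡ 0# → x + y + z ≡ x
    cancel x {y} {z} y+z≡0 = trans (+-assoc x y z) (trans (cong (x +_) y+z≡0) (+-identityʳ x))
    shift : Carrier ↔ Carrier
    shift = mk↔ₛ′ (_+ y) (_+ - y) (λ x → cancel x (-‿inverseˡ y)) (λ x → cancel x (-‿inverseʳ y))

  sum-agree-off : ∀ {n} (f g : Fin n → Carrier) i → (∀ j → j ≢ i → f j ≡ g j) →
                  sum f + g i ≡ sum g + f i
  sum-agree-off f g zero agree = trans
    (cong (λ s → f zero + s + g zero) (sum-cong-≗ (λ j → agree (suc j) λ ())))
    (solve 3 (λ x y s → x :+ s :+ y := y :+ s :+ x) refl (f zero) (g zero) (sum (g ∘ suc)))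
  sum-agree-off f g (suc i) agree = begin
    f zero + sum (f ∘ suc) + g (suc i)    ≡⟨ +-assoc (f zero) _ _ ⟩
    f zero + (sum (f ∘ suc) + g (suc i))
      ≡⟨ cong₂ _+_ (agree zero λ ()) (sum-agree-off (f ∘ suc) (g ∘ suc) i (λ j j≢i → agree (suc j)
        (j≢i ∘ Fin.suc-injective))) ⟩
    g zero + (sum (g ∘ suc) + f (suc i))  ≡⟨ +-assoc (g zero) _ _ ⟨
    g zero + sum (g ∘ suc) + f (suc i)    ∎

  -- Serves to change an integrand at a single point, such as the pole of a Möbius map. The form
  -- without subtraction lets an induction over `Fin` prove it.
  ∑-agree-off : ∀ f g y → (∀ x → x ≢ y → f x ≡ g x) → ∑ f + g y ≡ ∑ g + f y
  ∑-agree-off f g y agree = subst (λ z → ∑ f + g z ≡ ∑ g + f z) (Inverse.strictlyInverseˡ enumeration y)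
    (sum-agree-off (f ∘ element) (g ∘ element) i λ j j≢i → agree (element j) λ ej≡y →
      j≢i (trans (sym (Inverse.strictlyInverseʳ enumeration j)) (cong (Inverse.from enumeration) ej≡y)))
    where i = Inverse.from enumeration y

  -- The `n`-th power of `p · 1#` is `q · 1#`, which is the sum of the constant 1 over the field and
  -- so 0; a field has no nilpotents.
  characteristic : ∀ p n → q ≡ p ℕ.^ n → p · 1# ≡ 0#
  characteristic p n q≡pⁿ = ^-zero _ n (begin
    (p · 1#) ↑ n     ≡⟨ ·-^ n ⟨
    (p ℕ.^ n) · 1#   ≡⟨ cong (_· 1#) q≡pⁿ ⟨
    q · 1#           ≡⟨ sum-replicate q ⟨
    ∑ (λ _ → 1#)     ≡⟨ ∑-const 1# ⟩
    0#               ∎)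
    where
    ·-^ : ∀ n → (p ℕ.^ n) · 1# ≡ (p · 1#) ↑ n
    ·-^ zero = +-identityʳ 1#
    ·-^ (suc n) = trans (×1-homo-* p (p ℕ.^ n)) (cong (p · 1# *_) (·-^ n))

  -- The vector (a₀, …, a_{d-1}) stands for the monic polynomial
  -- a₀ + a₁X + … + a_{d-1}X^{d-1} + X^d.
  monic : ∀ {d} → Vec Carrier d → Carrier → Carrier
  monic [] x = 1#
  monic (a ∷ p) x = a + x * monic p x

  -- Synthetic division by X - y: the coefficients are the Horner values at `y` of the successive
  -- tails.
  quotient : ∀ {d} → Vec Carrier (suc d) → Carrier → Vec Carrier d
  quotient (a ∷ []) y = []
  quotient (a ∷ b ∷ p) y = monic (b ∷ p) y ∷ quotient (b ∷ p) y

  -- Division with remainder at the point x = y + z. Writing z for x - y avoids negation, so the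
  -- identity holds in any commutative semiring.
  monic-quotient : ∀ {d} (p : Vec Carrier (suc d)) y z →
                   monic p (y + z) ≡ z * monic (quotient p y) (y + z) + monic p y
  monic-quotient (a ∷ []) y z =
    solve 3 (λ a y z → a :+ (y :+ z) :* con 1 := z :* con 1 :+ (a :+ y :* con 1)) refl a y z
  monic-quotient (a ∷ p@(_ ∷ _)) y z = trans (cong (λ w → a + (y + z) * w) (monic-quotient p y z))
    (solve 5 (λ a y z P Q → a :+ (y :+ z) :* (z :* Q :+ P) := z :* (P :+ (y :+ z) :* Q) :+ (a :+ y :* P)) refl
      a y z (monic p y) (monic (quotient p y) (y + z)))

  -- Induction on the degree: after division by X - y for the first root y, the remaining roots are
  -- roots of the quotient, as they differ from y.
  monic-roots : ∀ {d} (p : Vec Carrier d) (f : Fin (suc d) → Carrier) →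
                Injective _≡_ _≡_ f → ¬ (∀ i → monic p (f i) ≡ 0#)
  monic-roots [] f f-inj root = 0≢1 (sym (root zero))
  monic-roots p@(_ ∷ _) f f-inj root = monic-roots (quotient p y) (f ∘ suc) (Fin.suc-injective ∘ f-inj) root′
    where
    y = f zero
    root′ : ∀ i → monic (quotient p y) (f (suc i)) ≡ 0#
    root′ i = *-cancelˡ-0 (x≢y⇒x-y≢0 λ e → Fin.0≢1+n (sym (f-inj e))) (begin
      z * monic (quotient p y) (f (suc i))             ≡⟨ cong (λ x → z * monic (quotient p y) x) y+z≡x ⟨
      z * monic (quotient p y) (y + z)                 ≡⟨ +-identityʳ _ ⟨
      z * monic (quotient p y) (y + z) + 0#            ≡⟨ cong (z * monic (quotient p y) (y + z) +_) (root zero) ⟨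
      z * monic (quotient p y) (y + z) + monic p y     ≡⟨ monic-quotient p y z ⟨
      monic p (y + z)                                  ≡⟨ cong (monic p) y+z≡x ⟩
      monic p (f (suc i))                              ≡⟨ root (suc i) ⟩
      0#                                               ∎)
      where
      z = f (suc i) - y
      y+z≡x : y + z ≡ f (suc i)
      y+z≡x = begin
        y + (f (suc i) - y)    ≡⟨ +-comm y z ⟩
        f (suc i) - y + y      ≡⟨ +-assoc (f (suc i)) (- y) y ⟩
        f (suc i) + (- y + y)  ≡⟨ cong (f (suc i) +_) (-‿inverseˡ y) ⟩
        f (suc i) + 0#         ≡⟨ +-identityʳ _ ⟩
        f (suc i)              ∎

  monic-nonvanishing : ∀ {d} (p : Vec Carrier d) → suc d ≤ q → ¬ (∀ x → monic p x ≡ 0#)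
  monic-nonvanishing p d<q vanish = monic-roots p (λ i → element (inject≤ i d<q))
    (Fin.inject≤-injective d<q d<q _ _ ∘ element-injective) (λ i → vanish (element (inject≤ i d<q)))

  monic-zeros : ∀ d x → monic (replicate d 0#) x ≡ x ↑ d
  monic-zeros zero x = refl
  monic-zeros (suc d) x = trans (+-identityˡ _) (cong (x *_) (monic-zeros d x))

  -- Replacing x by yx multiplies the sum by yᵏ. A nonzero sum would therefore force yᵏ = 1 for
  -- every y ≠ 0, and the monic polynomial Xᵏ⁺¹ - X, of degree below q, would vanish on the whole
  -- field. No generator of the multiplicative group is required.
  ∑-^ : ∀ k → 2 ℕ.+ k ≤ q → ∑ (_↑ k) ≡ 0#
  ∑-^ zero _ = ∑-const 1#
  ∑-^ (suc j) k<q-1 = decidable-stable (∑ (_↑ k) ≟ 0#) λ ∑≢0 →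
    -- The vector encodes Xᵏ⁺¹ - X; the factor X takes care of the point 0.
    monic-nonvanishing (0# ∷ - 1# ∷ replicate j 0#) k<q-1 (vanish ∑≢0)
    where
    k = suc j
    scale : ∀ y → y ≢ 0# → Carrier ↔ Carrier
    scale y y≢0 = mk↔ₛ′ (y *_) (y ⁻¹ *_)
      (λ x → trans (sym (*-assoc y (y ⁻¹) x)) (trans (cong (_* x) (⁻¹-inverse y y≢0)) (*-identityˡ x)))
      (λ x → trans (sym (*-assoc (y ⁻¹) y x)) (trans (cong (_* x) (trans (*-comm (y ⁻¹) y) (⁻¹-inverse y y≢0)))
        (*-identityˡ x)))
    invariant : ∀ y → y ≢ 0# → y ↑ k * ∑ (_↑ k) ≡ ∑ (_↑ k)
    invariant y y≢0 = begin
      y ↑ k * ∑ (_↑ k)              ≡⟨ ∑-* (y ↑ k) (_↑ k) ⟨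
      ∑ (λ x → y ↑ k * x ↑ k)       ≡⟨ ∑-cong (λ x → ^-distrib-* y x k) ⟨
      ∑ (λ x → (y * x) ↑ k)         ≡⟨ ∑-permutation (_↑ k) (scale y y≢0) ⟩
      ∑ (_↑ k)                      ∎
    root-of-unity : ∑ (_↑ k) ≢ 0# → ∀ y → y ≢ 0# → - 1# + y ↑ k ≡ 0#
    root-of-unity ∑≢0 y y≢0 = *-cancelˡ-0 ∑≢0 (begin
      s * (- 1# + y ↑ k)       ≡⟨ distribˡ s (- 1#) (y ↑ k) ⟩
      s * - 1# + s * y ↑ k     ≡⟨ cong (_+ s * y ↑ k) (-‿distribʳ-* s 1#) ⟨
      - (s * 1#) + s * y ↑ k
        ≡⟨ cong₂ (λ z w → - z + w) (*-identityʳ s) (trans (*-comm s (y ↑ k)) (invariant y y≢0)) ⟩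
      - s + s                  ≡⟨ -‿inverseˡ s ⟩
      0#                       ∎)
      where s = ∑ (_↑ k)
    vanish : ∑ (_↑ k) ≢ 0# → ∀ x → monic (0# ∷ - 1# ∷ replicate j 0#) x ≡ 0#
    vanish ∑≢0 x = trans (+-identityˡ _) (trans (cong (λ z → x * (- 1# + x * z)) (monic-zeros j x)) product≡0)
      where
      product≡0 : x * (- 1# + x ↑ k) ≡ 0#
      product≡0 with x ≟ 0#
      ... | yes x≡0 = trans (cong (_* (- 1# + x ↑ k)) x≡0) (zeroˡ _)
      ... | no x≢0 = trans (cong (x *_) (root-of-unity ∑≢0 x x≢0)) (zeroʳ x)

-- Characteristic 3: a ring solver over 𝔽₃ and formal combinations of monomials.

-- As coefficients of the ring solver, 𝔽₃ lets it prove the identities that hold only in characteristic 3.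
data 𝔽₃ : Set where
  0₃ 1₃ 2₃ : 𝔽₃

𝔽₃-rawRing : RawRing 0ℓ 0ℓ
𝔽₃-rawRing = record { _≈_ = _≡_ ; _+_ = _+₃_ ; _*_ = _*₃_ ; -_ = -₃_ ; 0# = 0₃ ; 1# = 1₃ }
  where
  _+₃_ _*₃_ : 𝔽₃ → 𝔽₃ → 𝔽₃
  0₃ +₃ y = y
  1₃ +₃ 0₃ = 1₃
  1₃ +₃ 1₃ = 2₃
  1₃ +₃ 2₃ = 0₃
  2₃ +₃ 0₃ = 2₃
  2₃ +₃ 1₃ = 0₃
  2₃ +₃ 2₃ = 1₃
  0₃ *₃ y = 0₃
  1₃ *₃ y = y
  2₃ *₃ 0₃ = 0₃
  2₃ *₃ 1₃ = 2₃
  2₃ *₃ 2₃ = 1₃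
  -₃_ : 𝔽₃ → 𝔽₃
  -₃ 0₃ = 0₃
  -₃ 1₃ = 2₃
  -₃ 2₃ = 1₃

-- Linear combinations of monomials xᵐvᵏ, the entry (a , m , k) standing for a xᵐvᵏ, over an arbitrary
-- type of coefficients so that they are available for field elements and for solver polynomials alike.
module Combination {A : Set} (_+_ _*_ : A → A → A) (_^_ : A → ℕ → A) (0# : A) where

  evaluate : List (A × ℕ × ℕ) → A → A → A
  evaluate [] x v = 0#
  evaluate ((a , m , k) ∷ ts) x v = (a * ((x ^ m) * (v ^ k))) + evaluate ts x v

  module _ (c : A) (τ : ℕ → A) where

    -- The sum over the field of xᵐvᵏ, when x²v = c(1 + v) and τ k is the sum of vᵏ.
    reduce : ℕ → ℕ → A
    reduce m zero = 0#
    reduce zero (suc k) = τ (suc k)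
    reduce (suc zero) (suc k) = 0#
    reduce (suc (suc m)) (suc k) = c * (reduce m k + reduce m (suc k))

    total : List (A × ℕ × ℕ) → A
    total [] = 0#
    total ((a , m , k) ∷ ts) = (a * reduce m k) + total ts

-- τ 0 is never used.
τ : ∀ {A : Set} → A → A → A → A → ℕ → A
τ t₁ t₂ t₃ t₄ 1 = t₁
τ t₁ t₂ t₃ t₄ 2 = t₂
τ t₁ t₂ t₃ t₄ 3 = t₃
τ t₁ t₂ t₃ t₄ _ = t₄

HasCharacteristic3 : ∀ {q} → FiniteField q → Set
HasCharacteristic3 F = 1# + 1# + 1# ≡ 0#
  where open FiniteField F

module Characteristic3 {q : ℕ} (F : FiniteField q)
  (1+1+1≡0 : HasCharacteristic3 F) where
  open FiniteFieldProperties F public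

  ⟦_⟧₃ : 𝔽₃ → Carrier
  ⟦ 0₃ ⟧₃ = 0#
  ⟦ 1₃ ⟧₃ = 1#
  ⟦ 2₃ ⟧₃ = - 1#

  1+1≡-1 : 1# + 1# ≡ - 1#
  1+1≡-1 = +-inverseˡ-unique (1# + 1#) 1# 1+1+1≡0

  𝔽₃-morphism : 𝔽₃-rawRing -Raw-AlmostCommutative⟶ fromCommutativeRing commutativeRing
  𝔽₃-morphism = record { ⟦_⟧ = ⟦_⟧₃ ; +-homo = +-homo ; *-homo = *-homo ; -‿homo = -‿homo ; 0-homo = refl ; 1-homo = refl }
    where
    open RawRing 𝔽₃-rawRing using () renaming (_+_ to _+₃_; _*_ to _*₃_; -_ to -₃_)
    +-homo : ∀ x y → ⟦ x +₃ y ⟧₃ ≡ ⟦ x ⟧₃ + ⟦ y ⟧₃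
    +-homo 0₃ y = sym (+-identityˡ ⟦ y ⟧₃)
    +-homo 1₃ 0₃ = sym (+-identityʳ 1#)
    +-homo 1₃ 1₃ = sym 1+1≡-1
    +-homo 1₃ 2₃ = sym (-‿inverseʳ 1#)
    +-homo 2₃ 0₃ = sym (+-identityʳ (- 1#))
    +-homo 2₃ 1₃ = sym (-‿inverseˡ 1#)
    +-homo 2₃ 2₃ = sym (begin
      - 1# + - 1#          ≡⟨ cong (_+ - 1#) 1+1≡-1 ⟨
      1# + 1# + - 1#       ≡⟨ +-assoc 1# 1# (- 1#) ⟩
      1# + (1# + - 1#)     ≡⟨ cong (1# +_) (-‿inverseʳ 1#) ⟩
      1# + 0#              ≡⟨ +-identityʳ 1# ⟩
      1#                   ∎)
    *-homo : ∀ x y → ⟦ x *₃ y ⟧₃ ≡ ⟦ x ⟧₃ * ⟦ y ⟧₃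
    *-homo 0₃ y = sym (zeroˡ ⟦ y ⟧₃)
    *-homo 1₃ y = sym (*-identityˡ ⟦ y ⟧₃)
    *-homo 2₃ 0₃ = sym (zeroʳ (- 1#))
    *-homo 2₃ 1₃ = sym (*-identityʳ (- 1#))
    *-homo 2₃ 2₃ = sym (begin
      - 1# * - 1#    ≡⟨ -‿distribˡ-* 1# (- 1#) ⟨
      - (1# * - 1#)  ≡⟨ cong -_ (*-identityˡ (- 1#)) ⟩
      - - 1#         ≡⟨ -‿involutive 1# ⟩
      1#             ∎)
    -‿homo : ∀ x → ⟦ -₃ x ⟧₃ ≡ - ⟦ x ⟧₃
    -‿homo 0₃ = trans (sym (-‿inverseˡ 0#)) (+-identityʳ (- 0#))
    -‿homo 1₃ = refl
    -‿homo 2₃ = sym (-‿involutive 1#)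

  _≟₃_ : ∀ x y → Maybe (⟦ x ⟧₃ ≡ ⟦ y ⟧₃)
  0₃ ≟₃ 0₃ = just refl
  1₃ ≟₃ 1₃ = just refl
  2₃ ≟₃ 2₃ = just refl
  _ ≟₃ _ = nothing

  open RingSolver 𝔽₃-rawRing (fromCommutativeRing commutativeRing) 𝔽₃-morphism _≟₃_ public
    using (Polynomial; solve; con; _:+_; _:*_; _:-_; :-_; _:^_; _:=_)

  difference : ∀ {x y} → x ≡ y → x - y ≡ 0#
  difference {x} refl = -‿inverseʳ x

  module 𝕂 = Combination _+_ _*_ _↑_ 0#
  module ℙ {n} = Combination {Polynomial n} _:+_ _:*_ _:^_ (con 0₃)

  -- Pairing x with -x shows that twice the sum is 0, and 2 = -1 here, so that s = -(s + s).
  ∑-odd : ∀ f → (∀ x → f (- x) ≡ - f x) → ∑ f ≡ 0#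
  ∑-odd f odd = begin
    ∑ f                      ≡⟨ solve 1 (λ s → s := :- (s :+ s)) refl (∑ f) ⟩
    - (∑ f + ∑ f)            ≡⟨ cong (λ s → - (∑ f + s)) (∑-permutation f negation) ⟨
    - (∑ f + ∑ (f ∘ -_))     ≡⟨ cong -_ (∑-+ f (f ∘ -_)) ⟨
    - ∑ (λ x → f x + f (- x)) ≡⟨ cong -_ (∑-cong λ x → trans (cong (f x +_) (odd x)) (-‿inverseʳ (f x))) ⟩
    - ∑ (λ _ → 0#)           ≡⟨ cong -_ (∑-const 0#) ⟩
    - 0#                     ≡⟨ solve 0 (:- con 0₃ := con 0₃) refl ⟩
    0#                       ∎
    where
    negation : Carrier ↔ Carrier
    negation = mk↔ₛ′ -_ -_ -‿involutive -‿involutive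

-- Reduction of the sums of xᵐvᵏ to the sums of vᵏ.

module PowerSums {q : ℕ} (F : FiniteField q) (1+1+1≡0 : HasCharacteristic3 F)
  (27≤q : 27 ≤ q) (c : FiniteField.Carrier F) (nonsquare : ∀ x → FiniteField._*_ F x x ≢ c) where
  open Characteristic3 F 1+1+1≡0 public

  c≢0 : c ≢ 0#
  c≢0 c≡0 = nonsquare 0# (trans (zeroˡ 0#) (sym c≡0))

  x²-c≢0 : ∀ x → x * x - c ≢ 0#
  x²-c≢0 x = x≢y⇒x-y≢0 (nonsquare x)

  v : Carrier → Carrier
  v x = c * (x * x - c) ⁻¹

  v-inverse : ∀ x → (x * x - c) * v x ≡ c
  v-inverse x = begin
    (x * x - c) * (c * (x * x - c) ⁻¹)
      ≡⟨ solve 3 (λ u c i → u :* (c :* i) := u :* i :* c) refl (x * x - c) c ((x * x - c) ⁻¹) ⟩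
    (x * x - c) * (x * x - c) ⁻¹ * c      ≡⟨ cong (_* c) (⁻¹-inverse _ (x²-c≢0 x)) ⟩
    1# * c                                ≡⟨ *-identityˡ c ⟩
    c                                     ∎

  x²v : ∀ x → x * x * v x ≡ c * (1# + v x)
  x²v x = begin
    x * x * v x
      ≡⟨ solve 3 (λ x c v → x :* x :* v := (x :* x :- c) :* v :+ c :* v) refl x c (v x) ⟩
    (x * x - c) * v x + c * v x    ≡⟨ cong (_+ c * v x) (v-inverse x) ⟩
    c + c * v x                    ≡⟨ solve 2 (λ c v → c :+ c :* v := c :* (con 1₃ :+ v)) refl c (v x) ⟩
    c * (1# + v x)                 ∎

  v-even : ∀ x → v (- x) ≡ v x
  v-even x = cong (λ y → c * (y - c) ⁻¹) (solve 1 (λ x → :- x :* :- x := x :* x) refl x)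

  monomial : ℕ → ℕ → Carrier → Carrier
  monomial m k x = x ↑ m * v x ↑ k

  S : ℕ → ℕ → Carrier
  S m k = ∑ (monomial m k)

  T : ℕ → Carrier
  T k = ∑ (λ x → v x ↑ k)

  S-polynomial : ∀ m → m ≤ 25 → S m 0 ≡ 0#
  S-polynomial m m≤25 = trans (∑-cong λ x → *-identityʳ (x ↑ m)) (∑-^ m (ℕ.≤-trans (s≤s (s≤s m≤25)) 27≤q))

  S-1 : ∀ k → S 1 k ≡ 0#
  S-1 k = ∑-odd (monomial 1 k) λ x → begin
    - x * 1# * v (- x) ↑ k   ≡⟨ cong (λ z → - x * 1# * z ↑ k) (v-even x) ⟩
    - x * 1# * v x ↑ k       ≡⟨ solve 2 (λ x y → :- x :* con 1₃ :* y := :- (x :* con 1₃ :* y)) refl x (v x ↑ k) ⟩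
    - (x * 1# * v x ↑ k)     ∎

  S-step : ∀ m k → S (2 ℕ.+ m) (suc k) ≡ c * (S m k + S m (suc k))
  S-step m k = begin
    S (2 ℕ.+ m) (suc k)                                        ≡⟨ ∑-cong pointwise ⟩
    ∑ (λ x → c * (monomial m k x + monomial m (suc k) x))
      ≡⟨ ∑-* c (λ x → monomial m k x + monomial m (suc k) x) ⟩
    c * ∑ (λ x → monomial m k x + monomial m (suc k) x)
      ≡⟨ cong (c *_) (∑-+ (monomial m k) (monomial m (suc k))) ⟩
    c * (S m k + S m (suc k))                                  ∎
    where
    pointwise : ∀ x → monomial (2 ℕ.+ m) (suc k) x ≡ c * (monomial m k x + monomial m (suc k) x)
    pointwise x = begin
      x * (x * x ↑ m) * (v x * v x ↑ k)
        ≡⟨ solve 4 (λ x y v w → x :* (x :* y) :* (v :* w) :=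
            x :* x :* v :* (y :* w)) refl x (x ↑ m) (v x) (v x ↑ k) ⟩
      x * x * v x * (x ↑ m * v x ↑ k)     ≡⟨ cong (_* (x ↑ m * v x ↑ k)) (x²v x) ⟩
      c * (1# + v x) * (x ↑ m * v x ↑ k)
        ≡⟨ solve 4 (λ c y v w → c :* (con 1₃ :+ v) :* (y :* w) :=
            c :* (y :* w :+ y :* (v :* w))) refl c (x ↑ m) (v x) (v x ↑ k) ⟩
      c * (x ↑ m * v x ↑ k + x ↑ m * (v x * v x ↑ k)) ∎

  -- The clauses of `reduce` reflect vanishing power sums, the definition of `T`, oddness, and x²v =
  -- c(1 + v). The exponent of x only falls along the recursion, so one bound at the start suffices;
  -- 25 is q - 2 for the smallest field, q = 27.
  S-reduce : ∀ m k → m ≤ 25 → S m k ≡ 𝕂.reduce c T m k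
  S-reduce m zero m≤25 = S-polynomial m m≤25
  S-reduce zero (suc k) _ = ∑-cong λ x → *-identityˡ (v x ↑ suc k)
  S-reduce (suc zero) (suc k) _ = S-1 (suc k)
  S-reduce (suc (suc m)) (suc k) m+2≤25 =
    trans (S-step m k) (cong₂ (λ y z → c * (y + z)) (S-reduce m k m≤25) (S-reduce m (suc k) m≤25))
    where m≤25 = ℕ.≤-trans (ℕ.m≤n+m m 2) m+2≤25

  degree≤25? : (ts : List (Carrier × ℕ × ℕ)) → Dec (All (λ (_ , m , _) → m ≤ 25) ts)
  degree≤25? = all? λ (_ , m , _) → m ℕ.≤? 25

  ∑-evaluate : ∀ ts → All (λ (_ , m , _) → m ≤ 25) ts → ∑ (λ x → 𝕂.evaluate ts x (v x)) ≡ 𝕂.total c T ts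
  ∑-evaluate [] [] = ∑-const 0#
  ∑-evaluate ((a , m , k) ∷ ts) (m≤25 ∷ bounds) = begin
    ∑ (λ x → a * monomial m k x + 𝕂.evaluate ts x (v x))
      ≡⟨ ∑-+ (λ x → a * monomial m k x) (λ x → 𝕂.evaluate ts x (v x)) ⟩
    ∑ (λ x → a * monomial m k x) + ∑ (λ x → 𝕂.evaluate ts x (v x))
      ≡⟨ cong₂ _+_ (trans (∑-* a (monomial m k)) (cong (a *_) (S-reduce m k m≤25))) (∑-evaluate ts bounds) ⟩
    a * 𝕂.reduce c T m k + 𝕂.total c T ts ∎

  -- The degree bounds are settled by evaluation, which leaves only the expansion of `f` to be
  -- supplied.
  ∑-total : ∀ f ts {_ : True (degree≤25? ts)} → (∀ x → f x ≡ 𝕂.evaluate ts x (v x)) → ∑ f ≡ 𝕂.total c T ts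
  ∑-total f ts {bounds} expand = trans (∑-cong expand) (∑-evaluate ts (toWitness bounds))

  -- Möbius transformations fixing r and -r, and the relations they impose on the sums of vᵏ.

  module Möbius (α : Carrier) where

    -- The equation y = N(x) with the denominator cleared. The expression is xy + α(x + y) + c,
    -- symmetric in x and y, which is why `N` is an involution.
    N-graph : Carrier → Carrier → Carrier
    N-graph x y = y * (x + α) + (α * x + c)

    -- The Möbius transformation x ↦ -(αx + c)/(x + α), a permutation of the projective line exchanging
    -- -α and ∞; here -α is made a fixed point instead.
    N : Carrier → Carrier
    N x with x + α ≟ 0#
    ... | yes _ = x
    ... | no _ = - (α * x + c) * (x + α) ⁻¹

    N-fixed : ∀ x → x + α ≡ 0# → N x ≡ x
    N-fixed x x+α≡0 with x + α ≟ 0#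
    ... | yes _ = refl
    ... | no x+α≢0 = ⊥-elim (x+α≢0 x+α≡0)

    N-on-graph : ∀ x → x + α ≢ 0# → N-graph x (N x) ≡ 0#
    N-on-graph x x+α≢0 with x + α ≟ 0#
    ... | yes x+α≡0 = ⊥-elim (x+α≢0 x+α≡0)
    ... | no _ = begin
      - y * i * (x + α) + y
        ≡⟨ solve 3 (λ y i z → :- y :* i :* z :+ y := y :* (con 1₃ :- z :* i)) refl y i (x + α) ⟩
      y * (1# - (x + α) * i)       ≡⟨ cong (λ z → y * (1# - z)) (⁻¹-inverse (x + α) x+α≢0) ⟩
      y * (1# - 1#)                ≡⟨ solve 1 (λ y → y :* (con 1₃ :- con 1₃) := con 0₃) refl y ⟩
      0#                           ∎
      where
      y = α * x + c
      i = (x + α) ⁻¹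

    N-unique : ∀ x y → x + α ≢ 0# → N-graph x y ≡ 0# → N x ≡ y
    N-unique x y x+α≢0 graph = x-y≡0⇒x≡y (N x) y (*-cancelˡ-0 x+α≢0 (begin
      (x + α) * (N x - y)
        ≡⟨ solve 5 (λ x α c y z → (x :+ α) :* (z :- y) :=
            (z :* (x :+ α) :+ (α :* x :+ c)) :- (y :* (x :+ α) :+ (α :* x :+ c))) refl x α c y (N x) ⟩
      N-graph x (N x) - N-graph x y   ≡⟨ difference (trans (N-on-graph x x+α≢0) (sym graph)) ⟩
      0#                              ∎))

    -- Up to sign this is the determinant of the Möbius transformation; it is nonzero because c is
    -- not a square.
    D≢0 : α * α - c ≢ 0#
    D≢0 = x²-c≢0 α

    -- On the projective line only ∞ goes to -α. In formulas, (y + α)(x + α) differs from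
    -- `N-graph x y` by α² - c.
    N+α≢0 : ∀ x → x + α ≢ 0# → N x + α ≢ 0#
    N+α≢0 x x+α≢0 y+α≡0 = D≢0 (begin
      α * α - c
        ≡⟨ solve 4 (λ x α c y → α :* α :- c :=
            (y :+ α) :* (x :+ α) :- (y :* (x :+ α) :+ (α :* x :+ c))) refl x α c (N x) ⟩
      (N x + α) * (x + α) - N-graph x (N x)    ≡⟨ cong₂ (λ y z → y * (x + α) - z) y+α≡0 (N-on-graph x x+α≢0) ⟩
      0# * (x + α) - 0#                        ≡⟨ solve 1 (λ z → con 0₃ :* z :- con 0₃ := con 0₃) refl (x + α) ⟩
      0#                                       ∎)

    N-involutive : ∀ x → N (N x) ≡ x
    N-involutive x = by-cases (x + α ≟ 0#)
      where
      by-cases : Dec (x + α ≡ 0#) → N (N x) ≡ x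
      by-cases (yes x+α≡0) = trans (cong N (N-fixed x x+α≡0)) (N-fixed x x+α≡0)
      by-cases (no x+α≢0) = N-unique (N x) x (N+α≢0 x x+α≢0) (begin
        N-graph (N x) x
          ≡⟨ solve 4 (λ x α c y → x :* (y :+ α) :+ (α :* y :+ c) :=
              y :* (x :+ α) :+ (α :* x :+ c)) refl x α c (N x) ⟩
        N-graph x (N x)      ≡⟨ N-on-graph x x+α≢0 ⟩
        0#                   ∎)

    -- The reason is (αx + c)² - c(x + α)² = (α² - c)(x² - c). The proof multiplies by x² - c and
    -- writes the difference through the graph equation and the defining equations of v at x and at
    -- N(x).
    v-N : ∀ x → x + α ≢ 0# → (α * α - c) * v (N x) ≡ (x + α) * (x + α) * v x
    v-N x x+α≢0 = x-y≡0⇒x≡y _ _ (*-cancelˡ-0 (x²-c≢0 x) (begin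
      (x * x - c) * ((α * α - c) * v y - (x + α) * (x + α) * v x)
        ≡⟨ solve 6 (λ x α c y v w →
             (x :* x :- c) :* ((α :* α :- c) :* w :- (x :+ α) :* (x :+ α) :* v) :=
             (x :+ α) :* (x :+ α) :* ((y :* y :- c) :* w :- (x :* x :- c) :* v)
               :+ (y :* (x :+ α) :+ (α :* x :+ c)) :* w :* (α :* x :+ c :- y :* (x :+ α)))
             refl x α c y (v x) (v y) ⟩
      (x + α) * (x + α) * ((y * y - c) * v y - (x * x - c) * v x) + N-graph x y * v y * (α * x + c - y * (x + α))
        ≡⟨ cong₂ (λ s t → (x + α) * (x + α) * s + t * v y * (α * x + c - y * (x + α)))
             (difference (trans (v-inverse y) (sym (v-inverse x)))) (N-on-graph x x+α≢0) ⟩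
      (x + α) * (x + α) * 0# + 0# * v y * (α * x + c - y * (x + α))
        ≡⟨ solve 3 (λ s t u → s :* con 0₃ :+ con 0₃ :* t :* u :=
            con 0₃) refl ((x + α) * (x + α)) (v y) (α * x + c - y * (x + α)) ⟩
      0# ∎))
      where y = N x

    -- The sum of vᵏ is reindexed along `N` and rewritten by `v-N`. At the exceptional point -α,
    -- fixed by `N`, the true term is cᵏ while the rewritten one is 0, as k > 0; this accounts for
    -- the summand cᵏ.
    T-relation : ∀ j → (α * α - c) ↑ suc j * T (suc j) ≡ ∑ (λ x → ((x + α) * (x + α) * v x) ↑ suc j) + c ↑ suc j
    T-relation j = begin
      D ↑ k * T k                           ≡⟨ ∑-* (D ↑ k) (λ x → v x ↑ k) ⟨
      ∑ (λ x → D ↑ k * v x ↑ k)             ≡⟨ ∑-cong (λ x → ^-distrib-* D (v x) k) ⟨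
      ∑ (λ x → (D * v x) ↑ k)
        ≡⟨ ∑-permutation (λ x → (D * v x) ↑ k) (mk↔ₛ′ N N N-involutive N-involutive) ⟨
      ∑ f                                   ≡⟨ +-identityʳ (∑ f) ⟨
      ∑ f + 0#                              ≡⟨ cong (∑ f +_) g-vanishes ⟨
      ∑ f + g (- α)
        ≡⟨ ∑-agree-off f g (- α) (λ x x≢-α → cong (_↑ k) (v-N x (x≢-α ∘ +-inverseˡ-unique x α))) ⟩
      ∑ g + f (- α)                         ≡⟨ cong (λ z → ∑ g + z ↑ k) f-value ⟩
      ∑ g + c ↑ k                           ∎
      where
      k = suc j
      D = α * α - c
      f g : Carrier → Carrier
      f x = (D * v (N x)) ↑ k
      g x = ((x + α) * (x + α) * v x) ↑ k
      g-vanishes : g (- α) ≡ 0#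
      g-vanishes = solve 3 (λ α v w → (:- α :+ α) :* (:- α :+ α) :* v :* w :=
          con 0₃) refl α (v (- α)) (((- α + α) * (- α + α) * v (- α)) ↑ j)
      f-value : D * v (N (- α)) ≡ c
      f-value = begin
        D * v (N (- α))    ≡⟨ cong (λ y → D * v y) (N-fixed (- α) (-‿inverseˡ α)) ⟩
        D * v (- α)        ≡⟨ cong (D *_) (v-even α) ⟩
        D * v α            ≡⟨ v-inverse α ⟩
        c                  ∎

  -- The values of T₁, T₂, T₃, T₄.

  -- For α = 0, where N(x) = -c/x, the relation reads -cT₁ = cT₁ + c, and -2 = 1.
  T₁≡1 : T 1 ≡ 1#
  T₁≡1 = x-y≡0⇒x≡y (T 1) 1# (*-cancelˡ-0 c≢0 (begin
    c * (T 1 - 1#)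
      ≡⟨ solve 2 (λ c t → c :* (t :- con 1₃) :=
          (con 0₃ :* con 0₃ :- c) :^ 1 :* t :- (ℙ.total c (λ _ → t) ((con 1₃ , 2 , 1) ∷ []) :+ c :^ 1))
            refl c (T 1) ⟩
    (0# * 0# - c) ↑ 1 * T 1 - (𝕂.total c T ts + c ↑ 1)
      ≡⟨ difference (trans (T-relation 0) (cong (_+ c ↑ 1) (∑-total _ ts expand))) ⟩
    0#                                                          ∎))
    where
    open Möbius 0#
    ts = (1# , 2 , 1) ∷ []
    expand : ∀ x → ((x + 0#) * (x + 0#) * v x) ↑ 1 ≡ 𝕂.evaluate ts x (v x)
    expand x = solve 2 (λ x v → ((x :+ con 0₃) :* (x :+ con 0₃) :* v) :^ 1 :=
        ℙ.evaluate ((con 1₃ , 2 , 1) ∷ []) x v) refl x (v x)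

  -- For α = 0 the unknown T₂ cancels, so α = 1 is taken. There (x + 1)⁴ = x⁴ + x³ + x + 1, and T₁ =
  -- 1 leaves cT₂ = 0.
  T₂≡0 : T 2 ≡ 0#
  T₂≡0 = *-cancelˡ-0 c≢0 (begin
    c * T 2                                                     ≡⟨ identity (T 1) (T 2) T₁≡1 ⟩
    (1# * 1# - c) ↑ 2 * T 2 - (𝕂.total c T ts + c ↑ 2)
      ≡⟨ difference (trans (T-relation 1) (cong (_+ c ↑ 2) (∑-total _ ts expand))) ⟩
    0#                                                          ∎)
    where
    open Möbius 1#
    ts = (1# , 4 , 2) ∷ (1# , 3 , 2) ∷ (1# , 1 , 2) ∷ (1# , 0 , 2) ∷ []
    :ts : ∀ {n} → List (Polynomial n × ℕ × ℕ)
    :ts = (con 1₃ , 4 , 2) ∷ (con 1₃ , 3 , 2) ∷ (con 1₃ , 1 , 2) ∷ (con 1₃ , 0 , 2) ∷ []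
    expand : ∀ x → ((x + 1#) * (x + 1#) * v x) ↑ 2 ≡ 𝕂.evaluate ts x (v x)
    expand x = solve 2 (λ x v → ((x :+ con 1₃) :* (x :+ con 1₃) :* v) :^ 2 := ℙ.evaluate :ts x v) refl x (v x)
    -- With variables in place of the sums, matching on `refl` inserts their known values. Since the
    -- exponents are numerals, `𝕂.total c T ts` unfolds to an instance of this.
    identity : ∀ t₁ t₂ → t₁ ≡ 1# → c * t₂ ≡ (1# * 1# - c) ↑ 2 * t₂ - (𝕂.total c (τ t₁ t₂ 0# 0#) ts + c ↑ 2)
    identity t₁ t₂ refl = solve 2 (λ c t₂ → c :* t₂ :=
        (con 1₃ :* con 1₃ :- c) :^ 2 :* t₂ :- (ℙ.total c (τ (con 1₃) t₂ (con 0₃) (con 0₃)) :ts :+ c :^ 2))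
        refl c t₂

  -- For α = 0 the terms in T₁ and T₂ carry the coefficient 3, as (1 + v)³ = 1 + v³; what remains is
  -- -c³T₃ = c³T₃ + c³.
  T₃≡1 : T 3 ≡ 1#
  T₃≡1 = x-y≡0⇒x≡y (T 3) 1# (*-cancelˡ-0 (c≢0 ∘ ^-zero c 3) (begin
    c ↑ 3 * (T 3 - 1#)
      ≡⟨ solve 4 (λ c t₁ t₂ t₃ → c :^ 3 :* (t₃ :- con 1₃) :=
          (con 0₃ :* con 0₃ :- c) :^ 3 :* t₃ :- (ℙ.total c (τ t₁ t₂ t₃ (con 0₃)) ((con 1₃ , 6 , 3) ∷ []) :+ c :^ 3))
            refl c (T 1) (T 2) (T 3) ⟩
    (0# * 0# - c) ↑ 3 * T 3 - (𝕂.total c T ts + c ↑ 3)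
      ≡⟨ difference (trans (T-relation 2) (cong (_+ c ↑ 3) (∑-total _ ts expand))) ⟩
    0#                                                          ∎))
    where
    open Möbius 0#
    ts = (1# , 6 , 3) ∷ []
    expand : ∀ x → ((x + 0#) * (x + 0#) * v x) ↑ 3 ≡ 𝕂.evaluate ts x (v x)
    expand x = solve 2 (λ x v → ((x :+ con 0₃) :* (x :+ con 0₃) :* v) :^ 3 :=
        ℙ.evaluate ((con 1₃ , 6 , 3) ∷ []) x v) refl x (v x)

  -- The vector encodes α³ + cα. Once T₁, T₂, T₃ are inserted in the relation for k = 4, the factor
  -- of T₄ - 1 is c(α³ + cα)².
  T₄-relation : ∀ α → monic (0# ∷ c ∷ 0# ∷ []) α * (monic (0# ∷ c ∷ 0# ∷ []) α * (c * (T 4 - 1#))) ≡ 0#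
  T₄-relation α = begin
    monic p α * (monic p α * (c * (T 4 - 1#)))
      ≡⟨ identity (T 1) (T 2) (T 3) (T 4) T₁≡1 T₂≡0 T₃≡1 ⟩
    (α * α - c) ↑ 4 * T 4 - (𝕂.total c T ts + c ↑ 4)
      ≡⟨ difference (trans (T-relation 3) (cong (_+ c ↑ 4) (∑-total _ ts expand))) ⟩
    0#                                                          ∎
    where
    open Möbius α
    p = 0# ∷ c ∷ 0# ∷ []
    -- C(8,m) ≡ (-1)ᵐ (mod 3).
    ts = (1# , 8 , 4) ∷ (- α , 7 , 4) ∷ (α ↑ 2 , 6 , 4) ∷ (- (α ↑ 3) , 5 , 4) ∷ (α ↑ 4 , 4 , 4)
       ∷ (- (α ↑ 5) , 3 , 4) ∷ (α ↑ 6 , 2 , 4) ∷ (- (α ↑ 7) , 1 , 4) ∷ (α ↑ 8 , 0 , 4) ∷ []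
    :ts : ∀ {n} → Polynomial n → List (Polynomial n × ℕ × ℕ)
    :ts α = (con 1₃ , 8 , 4) ∷ (:- α , 7 , 4) ∷ (α :^ 2 , 6 , 4) ∷ (:- (α :^ 3) , 5 , 4) ∷ (α :^ 4 , 4 , 4)
          ∷ (:- (α :^ 5) , 3 , 4) ∷ (α :^ 6 , 2 , 4) ∷ (:- (α :^ 7) , 1 , 4) ∷ (α :^ 8 , 0 , 4) ∷ []
    expand : ∀ x → ((x + α) * (x + α) * v x) ↑ 4 ≡ 𝕂.evaluate ts x (v x)
    expand x = solve 3 (λ α x v → ((x :+ α) :* (x :+ α) :* v) :^ 4 := ℙ.evaluate (:ts α) x v) refl α x (v x)
    identity : ∀ t₁ t₂ t₃ t₄ → t₁ ≡ 1# → t₂ ≡ 0# → t₃ ≡ 1# →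
      monic p α * (monic p α * (c * (t₄ - 1#))) ≡ (α * α - c) ↑ 4 * t₄ - (𝕂.total c (τ t₁ t₂ t₃ t₄) ts + c ↑ 4)
    identity t₁ t₂ t₃ t₄ refl refl refl = solve 3 (λ c α t₄ →
      let p = con 0₃ :+ α :* (c :+ α :* (con 0₃ :+ α :* con 1₃)) in
      p :* (p :* (c :* (t₄ :- con 1₃))) :=
      (α :* α :- c) :^ 4 :* t₄ :- (ℙ.total c (τ (con 1₃) (con 0₃) (con 1₃) t₄) (:ts α) :+ c :^ 4)) refl c α t₄

  -- A root of α³ + cα makes the relation void, but a monic cubic cannot vanish on all of a field
  -- with at least 27 elements.
  T₄≡1 : T 4 ≡ 1#
  T₄≡1 = decidable-stable (T 4 ≟ 1#) λ T₄≢1 →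
    monic-nonvanishing (0# ∷ c ∷ 0# ∷ []) (ℕ.≤-trans (ℕ.m≤m+n 4 23) 27≤q) λ α →
      [ (λ p≡0 → p≡0) , [ (λ p≡0 → p≡0) , ⊥-elim ∘ x≢y⇒x-y≢0 T₄≢1 ∘ *-cancelˡ-0 c≢0 ]′ ∘ zero-product ]′
        (zero-product (T₄-relation α))

  -- The second and fifth power sums of f, and the contradiction.

  i : Carrier
  i = c ⁻¹

  φ : Carrier → Carrier → Carrier → Carrier
  φ a b x = a * (x * x) + b * x - i * (x * v x)

  module _ (a b : Carrier) (a≢0 : a ≢ 0#)
           (π : Carrier ↔ Carrier) (π≗φ : ∀ x → Inverse.to π x ≡ φ a b x) where

    ∑-φ : ∀ k → k ≤ 25 → ∑ (λ x → φ a b x ↑ k) ≡ 0#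
    ∑-φ k k≤25 = begin
      ∑ (λ x → φ a b x ↑ k)            ≡⟨ ∑-cong (λ x → cong (_↑ k) (π≗φ x)) ⟨
      ∑ (λ x → Inverse.to π x ↑ k)     ≡⟨ ∑-permutation (_↑ k) π ⟩
      ∑ (_↑ k)                         ≡⟨ ∑-^ k (ℕ.≤-trans (s≤s (s≤s k≤25)) 27≤q) ⟩
      0#                               ∎

    ci≡1 : c * i ≡ 1#
    ci≡1 = ⁻¹-inverse c c≢0

    b≡-i : b ≡ - i
    b≡-i = +-inverseˡ-unique b i (begin
      b + i                                         ≡⟨ identity (T 1) (T 2) T₁≡1 T₂≡0 ⟩
      -- The total is ci(b + i); the second summand replaces ci by 1, so that the solver sees a
      -- polynomial identity in independent variables.
      𝕂.total c T ts + (1# - c * i) * (b + i)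
        ≡⟨ cong₂ (λ s t → s + t * (b + i)) (trans (sym (∑-total _ ts expand)) (∑-φ 2 (ℕ.m≤m+n 2 23)))
             (difference (sym ci≡1)) ⟩
      0# + 0# * (b + i)
        ≡⟨ solve 1 (λ s → con 0₃ :+ con 0₃ :* s := con 0₃) refl (b + i) ⟩
      0#                                            ∎)
      where
      ts = (a * a , 4 , 0) ∷ (- (a * b) , 3 , 0) ∷ (b * b , 2 , 0) ∷ (a * i , 3 , 1) ∷ (b * i , 2 , 1)
        ∷ (i * i , 2 , 2) ∷ []
      :ts : ∀ {n} (a b i : Polynomial n) → List (Polynomial n × ℕ × ℕ)
      :ts a b i = (a :* a , 4 , 0) ∷ (:- (a :* b) , 3 , 0) ∷ (b :* b , 2 , 0) ∷ (a :* i , 3 , 1) ∷ (b :* i , 2 , 1)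
        ∷ (i :* i , 2 , 2) ∷ []
      expand : ∀ x → φ a b x ↑ 2 ≡ 𝕂.evaluate ts x (v x)
      expand x = solve 5 (λ a b i x v → (a :* (x :* x) :+ b :* x :- i :* (x :* v)) :^ 2 :=
          ℙ.evaluate (:ts a b i) x v) refl a b i x (v x)
      identity : ∀ t₁ t₂ → t₁ ≡ 1# → t₂ ≡ 0# → b + i ≡ 𝕂.total c (τ t₁ t₂ 0# 0#) ts + (1# - c * i) * (b + i)
      identity t₁ t₂ refl refl = solve 4 (λ a b c i → b :+ i :=
          ℙ.total c (τ (con 1₃) (con 0₃) (con 0₃) (con 0₃)) (:ts a b i) 
            :+ (con 1₃ :- c :* i) :* (b :+ i)) refl a b c i

    -- With b = -i the last two terms are -ix(1 + v), and 1 + v = i x²v. Two terms instead of three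
    -- keep the fifth power down to six monomials.
    φ≡ : ∀ x → φ a b x ≡ a * (x * x) - i * i * (x * (x * x * v x))
    φ≡ x = begin
      a * (x * x) + b * x - i * (x * v x)
        ≡⟨ cong (λ b → a * (x * x) + b * x - i * (x * v x)) b≡-i ⟩
      a * (x * x) + - i * x - i * (x * v x)
        ≡⟨ solve 4 (λ a i x v → a :* (x :* x) :+ :- i :* x :- i :* (x :* v) :=
            a :* (x :* x) :- i :* x :* (con 1₃ :* (con 1₃ :+ v))) refl a i x (v x) ⟩
      a * (x * x) - i * x * (1# * (1# + v x))
        ≡⟨ cong (λ s → a * (x * x) - i * x * (s * (1# + v x))) ci≡1 ⟨
      a * (x * x) - i * x * (c * i * (1# + v x))
        ≡⟨ solve 5 (λ a c i x v → a :* (x :* x) :- i :* x :* (c :* i :* (con 1₃ :+ v)) :=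
            a :* (x :* x) :- i :* i :* (x :* (c :* (con 1₃ :+ v)))) refl a c i x (v x) ⟩
      a * (x * x) - i * i * (x * (c * (1# + v x)))         ≡⟨ cong (λ s → a * (x * x) - i * i * (x * s)) (x²v x) ⟨
      a * (x * x) - i * i * (x * (x * x * v x))            ∎

    -- With e = i², odd powers of x drop out of the sum of φ⁵, as does x¹⁰. The sum of x¹²v² is
    -- c⁶(6T₁ + T₂) = 0, and that of x¹⁴v⁴ is c⁷(T₄ + 7T₃ + 21T₂ + 35T₁) = c⁷. This leaves -ae⁴c⁷,
    -- which is -a/c.
    ac⁷i⁸≡0 : a * (c ↑ 7 * i ↑ 8) ≡ 0#
    ac⁷i⁸≡0 = begin
      a * (c ↑ 7 * i ↑ 8)      ≡⟨ identity (T 1) (T 2) (T 3) (T 4) T₁≡1 T₂≡0 T₃≡1 T₄≡1 ⟩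
      - 𝕂.total c T ts         ≡⟨ cong -_ (trans (sym (∑-total _ ts expand)) (∑-φ 5 (ℕ.m≤m+n 5 20))) ⟩
      - 0#                     ≡⟨ solve 0 (:- con 0₃ := con 0₃) refl ⟩
      0#                       ∎
      where
      e = i * i
      -- Modulo 3 the coefficients (-1)ʲC(5,j) are 1, 1, 1, -1, -1, -1.
      ts = (a ↑ 5 , 10 , 0) ∷ (a ↑ 4 * e , 11 , 1) ∷ (a ↑ 3 * e ↑ 2 , 12 , 2) ∷ (- (a ↑ 2 * e ↑ 3) , 13 , 3)
         ∷ (- (a * e ↑ 4) , 14 , 4) ∷ (- (e ↑ 5) , 15 , 5) ∷ []
      :ts : ∀ {n} (a e : Polynomial n) → List (Polynomial n × ℕ × ℕ)
      :ts a e = (a :^ 5 , 10 , 0) ∷ (a :^ 4 :* e , 11 , 1) ∷ (a :^ 3 :* e :^ 2 , 12 , 2) 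
         ∷ (:- (a :^ 2 :* e :^ 3) , 13 , 3) ∷ (:- (a :* e :^ 4) , 14 , 4) ∷ (:- (e :^ 5) , 15 , 5) ∷ []
      expand : ∀ x → φ a b x ↑ 5 ≡ 𝕂.evaluate ts x (v x)
      expand x = trans (cong (_↑ 5) (φ≡ x)) (solve 4 (λ a e x v →
        (a :* (x :* x) :- e :* (x :* (x :* x :* v))) :^ 5 := ℙ.evaluate (:ts a e) x v) refl a e x (v x))
      identity : ∀ t₁ t₂ t₃ t₄ → t₁ ≡ 1# → t₂ ≡ 0# → t₃ ≡ 1# → t₄ ≡ 1# →
        a * (c ↑ 7 * i ↑ 8) ≡ - 𝕂.total c (τ t₁ t₂ t₃ t₄) ts
      identity t₁ t₂ t₃ t₄ refl refl refl refl = solve 3 (λ a c i →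
        a :* (c :^ 7 :* i :^ 8) :=
            :- ℙ.total c (τ (con 1₃) (con 0₃) (con 1₃) (con 1₃)) (:ts a (i :* i))) refl a c i

    φ-not-permutation : ⊥
    φ-not-permutation = 0≢1 (begin
      0#       ≡⟨ zeroʳ c ⟨
      c * 0#   ≡⟨ cong (c *_) i≡0 ⟨
      c * i    ≡⟨ ci≡1 ⟩
      1#       ∎)
      where
      i≡0 : i ≡ 0#
      i≡0 = ^-zero i 8 (*-cancelˡ-0 (c≢0 ∘ ^-zero c 7) (*-cancelˡ-0 a≢0 ac⁷i⁸≡0))

-- Descent from L to K: the given map as a permutation of K.

module EmbeddingProperties {q q′ : ℕ} {K : FiniteField q} {L : FiniteField q′} (e : Embedding K L) where
  private
    module K = FiniteFieldProperties K
    module L = FiniteFieldProperties L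
  open Embedding e

  ι-0 : ι K.0# ≡ L.0#
  ι-0 = L.+-identityʳ-unique (ι K.0#) (ι K.0#) (trans (sym (ι-+ K.0# K.0#)) (cong ι (K.+-identityʳ K.0#)))

  ι-neg : ∀ x → ι (K.- x) ≡ L.- ι x
  ι-neg x = L.+-inverseˡ-unique (ι (K.- x)) (ι x) (begin
    ι (K.- x) L.+ ι x    ≡⟨ ι-+ (K.- x) x ⟨
    ι (K.- x K.+ x)      ≡⟨ cong ι (K.-‿inverseˡ x) ⟩
    ι K.0#               ≡⟨ ι-0 ⟩
    L.0#                 ∎)

  ι-sub : ∀ x y → ι (x K.- y) ≡ ι x L.- ι y
  ι-sub x y = trans (ι-+ x (K.- y)) (cong (ι x L.+_) (ι-neg y))

theorem4p3 : (n : ℕ) → 3 ≤ n →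
    (K : FiniteField (3 ^ n)) → (L : FiniteField ((3 ^ n) ^ 2)) →
    (e : Embedding K L) →
    (a b : FiniteField.Carrier K) → a ≢ FiniteField.0# K →
    (r : FiniteField.Carrier L) →
    (∀ x → Embedding.ι e x ≢ r) →
    (∃[ c ] Embedding.ι e c ≡ FiniteField._*_ L r r) →
    ¬ IsPermutationP1 e (fMap K L e a b r)
theorem4p3 n 3≤n K L e a b a≢0 r r∉K (c , ιc≡r²) (_ , injective , surjective) =
  P.φ-not-permutation a b a≢0 π (λ _ → refl)
  where
  open Embedding e
  open EmbeddingProperties e
  module K = FiniteFieldProperties K

  1+1+1≡0 : HasCharacteristic3 K
  1+1+1≡0 = begin
    K.1# K.+ K.1# K.+ K.1#               ≡⟨ K.+-assoc K.1# K.1# K.1# ⟩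
    K.1# K.+ (K.1# K.+ K.1#)             ≡⟨ cong (λ z → K.1# K.+ (K.1# K.+ z)) (K.+-identityʳ K.1#) ⟨
    K.1# K.+ (K.1# K.+ (K.1# K.+ K.0#))  ≡⟨ K.characteristic 3 n refl ⟩
    K.0#                                 ∎

  ι[1+1+1]≡0 : HasCharacteristic3 L
  ι[1+1+1]≡0 = begin
    1# + 1# + 1#                 ≡⟨ cong (λ z → z + z + z) ι-1 ⟨
    ι K.1# + ι K.1# + ι K.1#     ≡⟨ cong (_+ ι K.1#) (ι-+ K.1# K.1#) ⟨
    ι (K.1# K.+ K.1#) + ι K.1#   ≡⟨ ι-+ (K.1# K.+ K.1#) K.1# ⟨
    ι (K.1# K.+ K.1# K.+ K.1#)   ≡⟨ cong ι 1+1+1≡0 ⟩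
    ι K.0#                       ≡⟨ ι-0 ⟩
    0#                           ∎
    where open FiniteField L

  open Characteristic3 L ι[1+1+1]≡0

  ιx-r≢0 : ∀ x → ι x - r ≢ 0#
  ιx-r≢0 x = x≢y⇒x-y≢0 (r∉K x)

  ιx+r≢0 : ∀ x → ι x + r ≢ 0#
  ιx+r≢0 x ιx+r≡0 = r∉K (K.- x) (begin
    ι (K.- x)    ≡⟨ ι-neg x ⟩
    - ι x        ≡⟨ cong -_ (+-inverseˡ-unique (ι x) r ιx+r≡0) ⟩
    - - r        ≡⟨ -‿involutive r ⟩
    r            ∎)

  -- A square root x of c in K would satisfy (x - r)(x + r) = 0 in L and so place r in K.
  nonsquare : ∀ x → x K.* x ≢ c
  nonsquare x x²≡c = [ ιx-r≢0 x , ιx+r≢0 x ]′ (zero-product (begin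
    (ι x - r) * (ι x + r)      ≡⟨ solve 2 (λ x r → (x :- r) :* (x :+ r) := x :* x :- r :* r) refl (ι x) r ⟩
    ι x * ι x - r * r          ≡⟨ difference (trans (sym (ι-* x x)) (trans (cong ι x²≡c) ιc≡r²)) ⟩
    0#                         ∎))

  module P = PowerSums K 1+1+1≡0 (ℕ.^-monoʳ-≤ 3 3≤n) c nonsquare
  open P using (φ; v; i)

  module _ (x : K.Carrier) where
    X w y z : Carrier
    X = ι x
    w = ι (i K.* v x)
    y = (X - r) ⁻¹
    z = (X + r) ⁻¹

    -- In K, `i K.* v x` is 1/(x² - c), and `ι` carries c to r².
    [X²-r²]w≡1 : (X * X - r * r) * w ≡ 1#
    [X²-r²]w≡1 = begin
      (X * X - r * r) * w                      ≡⟨ cong (λ s → (X * X - s) * w) ιc≡r² ⟨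
      (X * X - ι c) * w                        ≡⟨ cong (λ s → (s - ι c) * w) (ι-* x x) ⟨
      (ι (x K.* x) - ι c) * w                  ≡⟨ cong (_* w) (ι-sub (x K.* x) c) ⟨
      ι (x K.* x K.- c) * w                    ≡⟨ ι-* _ _ ⟨
      ι ((x K.* x K.- c) K.* (i K.* v x))
        ≡⟨ cong ι (P.solve 3 (λ u i v → u P.:* (i P.:* v) P.:= u P.:* v P.:* i) refl (x K.* x K.- c) i (v x)) ⟩
      ι ((x K.* x K.- c) K.* v x K.* i)        ≡⟨ cong (λ s → ι (s K.* i)) (P.v-inverse x) ⟩
      ι (c K.* i)                              ≡⟨ cong ι (K.⁻¹-inverse c P.c≢0) ⟩
      ι K.1#                                   ≡⟨ ι-1 ⟩
      1#                                       ∎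

    -- In characteristic 3, 1/(X - r) + 1/(X + r) = 2X/(X² - r²) = -X/(X² - r²).
    -Xw≡y+z : - (X * w) ≡ y + z
    -Xw≡y+z = x-y≡0⇒x≡y _ _ (begin
      - (X * w) - (y + z)
        -- The difference is a combination of the relations (X - r)y = 1, (X + r)z = 1 and (X² -
        -- r²)w = 1, up to a term 3Xyz that vanishes.
        ≡⟨ solve 5 (λ X r y z w →
             :- (X :* w) :- (y :+ z) :=
             X :* w :* ((X :- r) :* y :* ((X :+ r) :* z) :- con 1₃) :- X :* y :* z :*
               ((X :* X :- r :* r) :* w :- con 1₃)
               :+ y :* ((X :+ r) :* z :- con 1₃) :+ z :* ((X :- r) :* y :- con 1₃)) refl X r y z w ⟩
      X * w * ((X - r) * y * ((X + r) * z) - 1#) - X * y * z * ((X * X - r * r) * w - 1#)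
        + y * ((X + r) * z - 1#) + z * ((X - r) * y - 1#)
        ≡⟨ vanish ((X - r) * y) ((X + r) * z) ((X * X - r * r) * w) (⁻¹-inverse _ (ιx-r≢0 x)) (⁻¹-inverse _
          (ιx+r≢0 x)) [X²-r²]w≡1 ⟩
      0# ∎)
      where
      vanish : ∀ s t u → s ≡ 1# → t ≡ 1# → u ≡ 1# →
        X * w * (s * t - 1#) - X * y * z * (u - 1#) + y * (t - 1#) + z * (s - 1#) ≡ 0#
      vanish s t u refl refl refl = solve 4 (λ X y z w →
        X :* w :* (con 1₃ :* con 1₃ :- con 1₃) :- X :* y :* z :* (con 1₃ :- con 1₃) :+ y :* (con 1₃ :- con 1₃) :+ z :* (con 1₃ :- con 1₃) :=
            con 0₃) refl X y z w

    ι-φ : ι (φ a b x) ≡ ι a * (X * X) + ι b * X + y + z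
    ι-φ = begin
      ι (a K.* (x K.* x) K.+ b K.* x K.- i K.* (x K.* v x))
        ≡⟨ ι-sub _ _ ⟩
      ι (a K.* (x K.* x) K.+ b K.* x) - ι (i K.* (x K.* v x))
        ≡⟨ cong₂ _-_ (ι-+ _ _) (cong ι (P.solve 3 (λ i x v → i P.:* (x P.:* v) P.:= x P.:* (i P.:* v)) refl i x
          (v x))) ⟩
      ι (a K.* (x K.* x)) + ι (b K.* x) - ι (x K.* (i K.* v x))
        ≡⟨ cong₂ _-_ (cong₂ _+_ (trans (ι-* _ _) (cong (ι a *_) (ι-* x x))) (ι-* b x)) (ι-* x (i K.* v x)) ⟩
      ι a * (X * X) + ι b * X + - (X * w)
        ≡⟨ cong (ι a * (X * X) + ι b * X +_) -Xw≡y+z ⟩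
      ι a * (X * X) + ι b * X + (y + z)
        ≡⟨ +-assoc _ y z ⟨
      ι a * (X * X) + ι b * X + y + z ∎

  fMap≡φ : ∀ x → fMap K L e a b r (just x) ≡ just (ι (φ a b x))
  fMap≡φ x = cong just (sym (ι-φ x))

  φ-injective : ∀ x y → φ a b x ≡ φ a b y → x ≡ y
  φ-injective x y φx≡φy = just-injective (injective (just x) (just y)
    (trans (fMap≡φ x) (trans (cong (just ∘ ι) φx≡φy) (sym (fMap≡φ y)))))

  φ-surjective : ∀ y → ∃[ x ] φ a b x ≡ y
  φ-surjective y with surjective (just y)
  -- A finite value has a finite preimage, since ∞ goes to ∞.
  ... | just x , fx≡y = x , ι-injective _ _ (just-injective (trans (sym (fMap≡φ x)) fx≡y))

  π : K.Carrier ↔ K.Carrier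
  π = mk↔ₛ′ (φ a b) (proj₁ ∘ φ-surjective) (proj₂ ∘ φ-surjective)
    (λ x → φ-injective _ _ (proj₂ (φ-surjective (φ a b x))))
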